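{- The GKAT axioms are sound for the language model: for all $e,f\in\mathrm{Exp}$, \[ e\equiv f \quad\Longrightarrow\quad [\![e]\!]=[\![f]\!]. \]
   Context: Syntax. Fix disjoint nonempty sets $\Sigma$ (actions) and $T=\{t_1,\dots,t_n\}$ (primitive tests), $T$ finite. Boolean expressions $b,c\in\mathrm{BExp}$ are generated by $0 \mid 1 \mid t\in T \mid b\cdot c \mid b+c \mid \overline{b}$. GKAT expressions $e,f,g\in\mathrm{Exp}$ are generated by $p\in\Sigma \mid b\in\mathrm{BExp} \mid e\cdot f \mid e+_b f \mid e^{(b)}$; $ef$ abbreviates $e\cdot f$. $\equiv_{BA}$ denotes Boolean equivalence, $b\le c$ iff $b+c\equiv_{BA}c$. $\mathrm{At}$ is the finite set of atoms (minimal nonzero elements) of the free Boolean algebra $\mathrm{BExp}/{\equiv_{BA}}$ on $T$. Language model. Guarded strings: $\mathrm{GS}=\mathrm{At}\cdot(\Sigma\cdot\mathrm{At})^*$. Fusion product: $x\alpha\diamond\beta y = x\alpha y$ if $\alpha=\beta$, undefined otherwise; for $L,K\subseteq\mathrm{GS}$, $L\diamond K=\{x\diamond y : x\in L,y\in K, x\diamond y\text{ defined}\}$; $L^0=\mathrm{At}$, $L^{n+1}=L^n\diamond L$. For $B\subseteq\mathrm{At}$, $\overline{B}=\mathrm{At}\setminus B$, $L+_BK=(B\diamond L)\cup(\overline{B}\diamond K)$, $L^{(B)}=\bigcup_{n\ge0}(B\diamond L)^n\diamond\overline{B}$. Then $[\![-]\!]:\mathrm{Exp}\to 2^{\mathrm{GS}}$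 is: $[\![p]\!]=\{\alpha p\beta:\alpha,\beta\in\mathrm{At}\}$, $[\![b]\!]=\{\alpha\in\mathrm{At}:\alpha\le b\}$, $[\![e\cdot f]\!]=[\![e]\!]\diamond[\![f]\!]$, $[\![e+_bf]\!]=[\![e]\!]+_{[\![b]\!]}[\![f]\!]$, $[\![e^{(b)}]\!]=[\![e]\!]^{([\![b]\!])}$. Axioms. $E:\mathrm{Exp}\to\mathrm{BExp}$ is defined by $E(b)=b$, $E(p)=0$, $E(e+_bf)=b\cdot E(e)+\overline{b}\cdot E(f)$, $E(e\cdot f)=E(e)\cdot E(f)$, $E(e^{(b)})=\overline{b}$. The relation $\equiv$ is the smallest congruence (with respect to all operators) on $\mathrm{Exp}$ such that $b\equiv_{BA}c$ implies $b\equiv c$ and, for all $e,f,g\in\mathrm{Exp}$, $b,c\in\mathrm{BExp}$: (U1) $e+_be\equiv e$; (U2) $e+_bf\equiv f+_{\overline{b}}e$; (U3) $(e+_bf)+_cg\equiv e+_{bc}(f+_cg)$; (U4) $e+_bf\equiv be+_bf$; (U5) $eg+_bfg\equiv(e+_bf)\cdot g$; (S1) $(e\cdot f)\cdot g\equiv e\cdot(f\cdot g)$; (S2) $0\cdot e\equiv0$; (S3) $e\cdot0\equiv0$; (S4) $1\cdot e\equiv e$; (S5) $e\cdot1\equiv e$; (W1) $e^{(b)}\equiv ee^{(b)}+_b1$; (W2) $(e+_c1)^{(b)}\equiv(ce)^{(b)}$; (W3) if $g\equiv eg+_bf$ and $E(e)\equiv0$, then $g\equiv e^{(b)}f$. 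-}

module Defs where

open import Algebra.Lattice.Bundles using (BooleanAlgebra)
open import Data.Fin.Base using (Fin)
open import Data.List.Base using (List; []; [_]; _++_; foldl)
open import Data.List.Relation.Binary.Equality.Setoid using (≋-setoid)
open import Data.Nat.Base using (ℕ; zero; suc)
open import Data.Product.Base using (_×_; _,_; proj₁; proj₂; ∃-syntax)
open import Data.Product.Relation.Binary.Pointwise.NonDependent using (×-setoid)
open import Data.Sum.Base using (inj₁; inj₂)
open import Level using (Level; 0ℓ) renaming (suc to ℓsuc)
open import Relation.Binary.Bundles using (Setoid)
open import Relation.Binary.Definitions using (_Respects_)
open import Relation.Binary.PropositionalEquality.Core using (_≡_)
open import Relation.Binary.PropositionalEquality.Properties using (setoid)
open import Relation.Nullary.Negation.Core using (¬_)
open import Relation.Unary using (Pred; _∈_; _∪_; ∁; U; ⋃)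
import Relation.Binary.Construct.On as On

private
  variable
    a : Level
    Act : Set a
    n : ℕ

------------------------------------------------------------------------
-- Boolean expressions over the primitive tests T = Fin n

infixr 7 _∧_
infixr 6 _∨_

data BExp (n : ℕ) : Set where
  𝟘 𝟙     : BExp n
  prim    : Fin n → BExp n
  _∧_ _∨_ : BExp n → BExp n → BExp n
  ∼_      : BExp n → BExp n

infix 4 _≡BA_ _≤BA_

-- Provability from the Boolean algebra axioms, so that BExp n modulo
-- _≡BA_ is the free Boolean algebra on n generators.

data _≡BA_ {n : ℕ} : BExp n → BExp n → Set where
  refl        : ∀ {b} → b ≡BA b
  sym         : ∀ {b c} → b ≡BA c → c ≡BA b
  trans       : ∀ {b c d} → b ≡BA c → c ≡BA d → b ≡BA d
  ∨-cong      : ∀ {b b′ c c′} → b ≡BA b′ → c ≡BA c′ → b ∨ c ≡BA b′ ∨ c′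
  ∧-cong      : ∀ {b b′ c c′} → b ≡BA b′ → c ≡BA c′ → b ∧ c ≡BA b′ ∧ c′
  ∼-cong      : ∀ {b b′} → b ≡BA b′ → ∼ b ≡BA ∼ b′
  ∨-comm      : ∀ b c → b ∨ c ≡BA c ∨ b
  ∨-assoc     : ∀ b c d → (b ∨ c) ∨ d ≡BA b ∨ (c ∨ d)
  ∧-comm      : ∀ b c → b ∧ c ≡BA c ∧ b
  ∧-assoc     : ∀ b c d → (b ∧ c) ∧ d ≡BA b ∧ (c ∧ d)
  ∨-absorbs-∧ : ∀ b c → b ∨ (b ∧ c) ≡BA b
  ∧-absorbs-∨ : ∀ b c → b ∧ (b ∨ c) ≡BA b
  ∨-distˡ-∧   : ∀ b c d → b ∨ (c ∧ d) ≡BA (b ∨ c) ∧ (b ∨ d)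
  ∨-distʳ-∧   : ∀ b c d → (c ∧ d) ∨ b ≡BA (c ∨ b) ∧ (d ∨ b)
  ∧-distˡ-∨   : ∀ b c d → b ∧ (c ∨ d) ≡BA (b ∧ c) ∨ (b ∧ d)
  ∧-distʳ-∨   : ∀ b c d → (c ∨ d) ∧ b ≡BA (c ∧ b) ∨ (d ∧ b)
  ∨-complˡ    : ∀ b → ∼ b ∨ b ≡BA 𝟙
  ∨-complʳ    : ∀ b → b ∨ ∼ b ≡BA 𝟙
  ∧-complˡ    : ∀ b → ∼ b ∧ b ≡BA 𝟘
  ∧-complʳ    : ∀ b → b ∧ ∼ b ≡BA 𝟘

freeBooleanAlgebra : ℕ → BooleanAlgebra 0ℓ 0ℓ
freeBooleanAlgebra n = record
  { Carrier = BExp n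
  ; _≈_ = _≡BA_
  ; _∨_ = _∨_
  ; _∧_ = _∧_
  ; ¬_ = ∼_
  ; ⊤ = 𝟙
  ; ⊥ = 𝟘
  ; isBooleanAlgebra = record
    { isDistributiveLattice = record
      { isLattice = record
        { isEquivalence = record { refl = refl ; sym = sym ; trans = trans }
        ; ∨-comm = ∨-comm
        ; ∨-assoc = ∨-assoc
        ; ∨-cong = ∨-cong
        ; ∧-comm = ∧-comm
        ; ∧-assoc = ∧-assoc
        ; ∧-cong = ∧-cong
        ; absorptive = ∨-absorbs-∧ , ∧-absorbs-∨
        }
      ; ∨-distrib-∧ = ∨-distˡ-∧ , ∨-distʳ-∧
      ; ∧-distrib-∨ = ∧-distˡ-∨ , ∧-distʳ-∨
      }
    ; ∨-complement = ∨-complˡ , ∨-complʳ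
    ; ∧-complement = ∧-complˡ , ∧-complʳ
    ; ¬-cong = ∼-cong
    }
  }

_≤BA_ : BExp n → BExp n → Set
b ≤BA c = b ∨ c ≡BA c

------------------------------------------------------------------------
-- Atoms: minimal nonzero elements of the free Boolean algebra. An atom
-- is given by a representative; equality of atoms is _≡BA_ on
-- representatives (_≈At_), never propositional equality.

record At (n : ℕ) : Set where
  field
    formula : BExp n
    nonzero : ¬ formula ≡BA 𝟘
    minimal : ∀ c → ¬ c ≡BA 𝟘 → c ≤BA formula → c ≡BA formula

open At public

At-setoid : ℕ → Setoid 0ℓ 0ℓ
At-setoid n = On.setoid (BooleanAlgebra.setoid (freeBooleanAlgebra n)) formula

infix 4 _≈At_

_≈At_ : At n → At n → Set
_≈At_ {n} = Setoid._≈_ (At-setoid n)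

------------------------------------------------------------------------
-- Guarded strings At · (Act · At)*

GS : Set a → ℕ → Set a
GS Act n = At n × List (Act × At n)

GS-setoid : Set a → ℕ → Setoid a a
GS-setoid Act n =
  ×-setoid (At-setoid n) (≋-setoid (×-setoid (setoid Act) (At-setoid n)))

infix 4 _≈GS_

_≈GS_ : {Act : Set a} → GS Act n → GS Act n → Set a
_≈GS_ {n = n} {Act} = Setoid._≈_ (GS-setoid Act n)

firstAtom : GS Act n → At n
firstAtom (α , _) = α

lastAtom : GS Act n → At n
lastAtom (α , u) = foldl (λ _ → proj₂) α u

-- Fusion x y z says that the partial product x ⋄ y is defined and
-- equal to z; the first atom of y is the one that is dropped.

Fusion : {Act : Set a} → GS Act n → GS Act n → GS Act n → Set a
Fusion x y z =
  lastAtom x ≈At firstAtom y × (firstAtom x , proj₂ x ++ proj₂ y) ≈GS z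

------------------------------------------------------------------------
-- Languages. All operations below yield predicates closed under _≈GS_,
-- i.e. subsets of the quotient (see ⟦⟧-resp-≈GS).

Lang : Set a → ℕ → Set (ℓsuc a)
Lang {a} Act n = Pred (GS Act n) a

-- A set of atoms, as a language of guarded strings without actions.

⌜_⌝ : {Act : Set a} → Pred (At n) 0ℓ → Lang Act n
⌜ B ⌝ z = ∃[ α ] α ∈ B × (α , []) ≈GS z

infixl 7 _⋄_
infixl 8 _^_

_⋄_ : Lang Act n → Lang Act n → Lang Act n
(L ⋄ K) z = ∃[ x ] ∃[ y ] x ∈ L × y ∈ K × Fusion x y z

_^_ : Lang Act n → ℕ → Lang Act n
L ^ zero  = ⌜ U ⌝
L ^ suc k = (L ^ k) ⋄ L

_+⟨_⟩_ : Lang Act n → Pred (At n) 0ℓ → Lang Act n → Lang Act n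
L +⟨ B ⟩ K = (⌜ B ⌝ ⋄ L) ∪ (⌜ ∁ B ⌝ ⋄ K)

_^⟨_⟩ : Lang Act n → Pred (At n) 0ℓ → Lang Act n
L ^⟨ B ⟩ = ⋃ ℕ λ k → ((⌜ B ⌝ ⋄ L) ^ k) ⋄ ⌜ ∁ B ⌝

------------------------------------------------------------------------
-- GKAT expressions

infixr 7 _·_
infixl 6 _+[_]_
infix  8 _^[_]

data Exp (Act : Set a) (n : ℕ) : Set a where
  act    : Act → Exp Act n
  test   : BExp n → Exp Act n
  _·_    : Exp Act n → Exp Act n → Exp Act n
  _+[_]_ : Exp Act n → BExp n → Exp Act n → Exp Act n
  _^[_]  : Exp Act n → BExp n → Exp Act n

⟦_⟧ᵗ : BExp n → Pred (At n) 0ℓ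
⟦ b ⟧ᵗ α = formula α ≤BA b

⟦_⟧ : Exp Act n → Lang Act n
⟦ act p ⟧ z    = ∃[ α ] ∃[ β ] (α , [ p , β ]) ≈GS z
⟦ test b ⟧     = ⌜ ⟦ b ⟧ᵗ ⌝
⟦ e · f ⟧      = ⟦ e ⟧ ⋄ ⟦ f ⟧
⟦ e +[ b ] f ⟧ = ⟦ e ⟧ +⟨ ⟦ b ⟧ᵗ ⟩ ⟦ f ⟧
⟦ e ^[ b ] ⟧   = ⟦ e ⟧ ^⟨ ⟦ b ⟧ᵗ ⟩

module _ {Act : Set a} {n : ℕ} where

  private
    trans-GS : (x y z : GS Act n) → x ≈GS y → y ≈GS z → x ≈GS z
    trans-GS x y z = Setoid.trans (GS-setoid Act n) {x} {y} {z}

  ⋄-resp-≈GS : (L K : Lang Act n) → (L ⋄ K) Respects _≈GS_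
  ⋄-resp-≈GS L K {z} {z′} z≈z′ (x , y , x∈L , y∈K , d , xy≈z) =
    x , y , x∈L , y∈K , d , trans-GS (firstAtom x , proj₂ x ++ proj₂ y) z z′ xy≈z z≈z′

  ⟦⟧-resp-≈GS : (e : Exp Act n) → ⟦ e ⟧ Respects _≈GS_
  ⟦⟧-resp-≈GS (act p) {z} {z′} z≈z′ (α , β , eq) =
    α , β , trans-GS (α , [ p , β ]) z z′ eq z≈z′
  ⟦⟧-resp-≈GS (test b) {z} {z′} z≈z′ (α , α≤b , eq) =
    α , α≤b , trans-GS (α , []) z z′ eq z≈z′
  ⟦⟧-resp-≈GS (e · f) {z} {z′} = ⋄-resp-≈GS ⟦ e ⟧ ⟦ f ⟧ {z} {z′}
  ⟦⟧-resp-≈GS (e +[ b ] f) {z} {z′} z≈z′ (inj₁ h) =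
    inj₁ (⋄-resp-≈GS ⌜ ⟦ b ⟧ᵗ ⌝ ⟦ e ⟧ {z} {z′} z≈z′ h)
  ⟦⟧-resp-≈GS (e +[ b ] f) {z} {z′} z≈z′ (inj₂ h) =
    inj₂ (⋄-resp-≈GS ⌜ ∁ ⟦ b ⟧ᵗ ⌝ ⟦ f ⟧ {z} {z′} z≈z′ h)
  ⟦⟧-resp-≈GS (e ^[ b ]) {z} {z′} z≈z′ (k , h) =
    k , ⋄-resp-≈GS ((⌜ ⟦ b ⟧ᵗ ⌝ ⋄ ⟦ e ⟧) ^ k) ⌜ ∁ ⟦ b ⟧ᵗ ⌝ {z} {z′} z≈z′ h

------------------------------------------------------------------------
-- The GKAT axioms

E : Exp Act n → BExp n
E (act p)      = 𝟘
E (test b)     = b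
E (e · f)      = E e ∧ E f
E (e +[ b ] f) = (b ∧ E e) ∨ (∼ b ∧ E f)
E (e ^[ b ])   = ∼ b

infix 4 _≡ᴳ_

data _≡ᴳ_ {a} {Act : Set a} {n : ℕ} : Exp Act n → Exp Act n → Set a where
  refl  : ∀ {e} → e ≡ᴳ e
  sym   : ∀ {e f} → e ≡ᴳ f → f ≡ᴳ e
  trans : ∀ {e f g} → e ≡ᴳ f → f ≡ᴳ g → e ≡ᴳ g

  -- Congruence for all operators, including in their Boolean arguments.
  ·-cong      : ∀ {e e′ f f′} → e ≡ᴳ e′ → f ≡ᴳ f′ → e · f ≡ᴳ e′ · f′
  +-cong      : ∀ {e e′ f f′ b b′} →
                e ≡ᴳ e′ → test {Act = Act} b ≡ᴳ test b′ → f ≡ᴳ f′ →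
                e +[ b ] f ≡ᴳ e′ +[ b′ ] f′
  ^-cong      : ∀ {e e′ b b′} →
                e ≡ᴳ e′ → test {Act = Act} b ≡ᴳ test b′ →
                e ^[ b ] ≡ᴳ e′ ^[ b′ ]
  test-∧-cong : ∀ {b b′ c c′} →
                test {Act = Act} b ≡ᴳ test b′ → test {Act = Act} c ≡ᴳ test c′ →
                test (b ∧ c) ≡ᴳ test (b′ ∧ c′)
  test-∨-cong : ∀ {b b′ c c′} →
                test {Act = Act} b ≡ᴳ test b′ → test {Act = Act} c ≡ᴳ test c′ →
                test (b ∨ c) ≡ᴳ test (b′ ∨ c′)
  test-∼-cong : ∀ {b b′} →
                test {Act = Act} b ≡ᴳ test b′ → test (∼ b) ≡ᴳ test (∼ b′)

  BA : ∀ {b c} → b ≡BA c → test b ≡ᴳ test c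

  -- For tests b and c, conjunction and sequential composition are written
  -- alike and "b · c" denotes one and the same expression; the two
  -- constructors are identified here.
  test-∧ : ∀ b c → test (b ∧ c) ≡ᴳ test b · test c

  U1 : ∀ e b → e +[ b ] e ≡ᴳ e
  U2 : ∀ e f b → e +[ b ] f ≡ᴳ f +[ ∼ b ] e
  U3 : ∀ e f g b c → (e +[ b ] f) +[ c ] g ≡ᴳ e +[ b ∧ c ] (f +[ c ] g)
  U4 : ∀ e f b → e +[ b ] f ≡ᴳ (test b · e) +[ b ] f
  U5 : ∀ e f g b → (e · g) +[ b ] (f · g) ≡ᴳ (e +[ b ] f) · g

  S1 : ∀ e f g → (e · f) · g ≡ᴳ e · (f · g)
  S2 : ∀ e → test 𝟘 · e ≡ᴳ test 𝟘
  S3 : ∀ e → e · test 𝟘 ≡ᴳ test 𝟘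
  S4 : ∀ e → test 𝟙 · e ≡ᴳ e
  S5 : ∀ e → e · test 𝟙 ≡ᴳ e

  W1 : ∀ e b → e ^[ b ] ≡ᴳ (e · e ^[ b ]) +[ b ] test 𝟙
  W2 : ∀ e b c → (e +[ c ] test 𝟙) ^[ b ] ≡ᴳ (test c · e) ^[ b ]
  W3 : ∀ {e f g b} → g ≡ᴳ (e · g) +[ b ] f →
       test {Act = Act} (E e) ≡ᴳ test 𝟘 → g ≡ᴳ e ^[ b ] · f

module Submission where

-- Up to ≈GS every fusion is a concatenation, so the semantics of an expression
-- can be computed without the quotient: products split the list of actions,
-- guarded sums look only at the first atom, and a loop is an inductive
-- predicate. There the axioms become elementary. Two points need an argument:
--
-- * U1, U2 and the Boolean congruences need each atom to decide each test. An
--   atom is nonzero, hence satisfied by some valuation v, and then minimality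
--   puts it below exactly the tests which v satisfies.
-- * W3: if E e is equivalent to 𝟘, no string of e is a single atom, so
--   X = e · X +[ b ] f has at most one solution, by induction on the length of
--   a string. Both sides of the conclusion solve it.

open import Defs
open import Data.Nat.Base using (ℕ; NonZero)
open import Relation.Unary using (_≐_)
import Algebra.Lattice.Properties.BooleanAlgebra as BooleanAlgebraProperties
open import Data.Bool.Base as Bool using (Bool; true; false; not)
import Data.Bool.Properties as Bool
open import Data.Empty using (⊥-elim)
open import Data.Fin.Base using (Fin; zero; suc)
open import Data.Fin.Subset using (Subset)
open import Data.Fin.Subset.Properties using (anySubset?)
open import Data.List.Base using (List; []; _∷_; [_]; _++_; length)
open import Data.List.Properties using (++-assoc; ++-identityʳ; foldl-++; length-++-≤ʳ)
open import Data.List.Relation.Binary.Pointwise using (Pointwise; []; _∷_)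
open import Data.Nat.Base using (zero; suc; _≤_; s≤s)
open import Data.Nat.Properties using (≤-refl; ≤-trans)
open import Data.Product.Base using (_×_; _,_; proj₁; proj₂; ∃-syntax)
open import Data.Sum.Base using (_⊎_; inj₁; inj₂; [_,_]′)
open import Data.Vec.Base using ([]; _∷_; lookup)
open import Function.Base using (_∘_; id)
open import Relation.Binary.Bundles using (Setoid)
import Relation.Binary.PropositionalEquality.Core as ≡
open ≡ using (_≡_)
open import Relation.Nullary.Decidable.Core using (yes; no)
open import Relation.Nullary.Negation.Core using (¬_; contradiction)
open import Relation.Unary using (Pred; _∈_; _⊆_; ∁; U; ⋃)
open import Relation.Unary.Properties using (≐-sym; ≐-trans)
open import Level using (Level; 0ℓ)

private
  variable
    a : Level
    Act : Set a
    n : ℕ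
    b c d : BExp n

-- The order of the free Boolean algebra

module FreeBA {n : ℕ} = BooleanAlgebraProperties (freeBooleanAlgebra n)

≤BA-reflexive : b ≡BA c → b ≤BA c
≤BA-reflexive {c = c} b≡c = trans (∨-cong b≡c refl) (FreeBA.∨-idem c)

≤BA-trans : b ≤BA c → c ≤BA d → b ≤BA d
≤BA-trans b≤c c≤d =
  trans (∨-cong refl (sym c≤d)) (trans (sym (∨-assoc _ _ _)) (trans (∨-cong b≤c refl) c≤d))

≤BA-resp : b ≡BA c → b ≤BA d → c ≤BA d
≤BA-resp b≡c = ≤BA-trans (≤BA-reflexive (sym b≡c))

≤BA-𝟙 : b ≤BA 𝟙
≤BA-𝟙 {b = b} = FreeBA.∨-zeroʳ b

≤BA-𝟘⇒≡ : b ≤BA 𝟘 → b ≡BA 𝟘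
≤BA-𝟘⇒≡ {b = b} = trans (sym (FreeBA.∨-identityʳ b))

∧-lowerˡ : b ∧ c ≤BA b
∧-lowerˡ = trans (∨-comm _ _) (∨-absorbs-∧ _ _)

∧-lowerʳ : b ∧ c ≤BA c
∧-lowerʳ = ≤BA-trans (≤BA-reflexive (∧-comm _ _)) ∧-lowerˡ

∧-greatest : d ≤BA b → d ≤BA c → d ≤BA b ∧ c
∧-greatest d≤b d≤c = trans (∨-distˡ-∧ _ _ _) (∧-cong d≤b d≤c)

∨-upperˡ : b ≤BA b ∨ c
∨-upperˡ = trans (sym (∨-assoc _ _ _)) (∨-cong (FreeBA.∨-idem _) refl)

∨-upperʳ : c ≤BA b ∨ c
∨-upperʳ = ≤BA-trans ∨-upperˡ (≤BA-reflexive (∨-comm _ _))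

∨-least : b ≤BA d → c ≤BA d → b ∨ c ≤BA d
∨-least b≤d c≤d = trans (∨-assoc _ _ _) (trans (∨-cong refl c≤d) b≤d)

≤BA-contradiction : d ≤BA b → d ≤BA ∼ b → d ≤BA c
≤BA-contradiction {b = b} {c = c} d≤b d≤∼b =
  ≤BA-trans (∧-greatest d≤b d≤∼b)
    (≤BA-trans (≤BA-reflexive (∧-complʳ b)) (FreeBA.∨-identityˡ c))

≤BA-cases : ∀ b → d ∧ b ≤BA c → d ∧ ∼ b ≤BA c → d ≤BA c
≤BA-cases {d = d} b d∧b≤c d∧∼b≤c =
  ≤BA-trans (≤BA-reflexive d≡) (∨-least d∧b≤c d∧∼b≤c)
  where
  d≡ : d ≡BA (d ∧ b) ∨ (d ∧ ∼ b)
  d≡ = trans (sym (FreeBA.∧-identityʳ d))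
         (trans (∧-cong refl (sym (∨-complʳ b))) (∧-distˡ-∨ d b (∼ b)))

-- Valuations

eval : Subset n → BExp n → Bool
eval v 𝟘        = false
eval v 𝟙        = true
eval v (prim t) = lookup v t
eval v (b ∧ c)  = eval v b Bool.∧ eval v c
eval v (b ∨ c)  = eval v b Bool.∨ eval v c
eval v (∼ b)    = not (eval v b)

eval-cong : (v : Subset n) → b ≡BA c → eval v b ≡ eval v c
eval-cong v refl                = ≡.refl
eval-cong v (sym p)             = ≡.sym (eval-cong v p)
eval-cong v (trans p q)         = ≡.trans (eval-cong v p) (eval-cong v q)
eval-cong v (∨-cong p q)        = ≡.cong₂ Bool._∨_ (eval-cong v p) (eval-cong v q)
eval-cong v (∧-cong p q)        = ≡.cong₂ Bool._∧_ (eval-cong v p) (eval-cong v q)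
eval-cong v (∼-cong p)          = ≡.cong not (eval-cong v p)
eval-cong v (∨-comm b c)        = Bool.∨-comm (eval v b) (eval v c)
eval-cong v (∨-assoc b c d)     = Bool.∨-assoc (eval v b) (eval v c) (eval v d)
eval-cong v (∧-comm b c)        = Bool.∧-comm (eval v b) (eval v c)
eval-cong v (∧-assoc b c d)     = Bool.∧-assoc (eval v b) (eval v c) (eval v d)
eval-cong v (∨-absorbs-∧ b c)   = Bool.∨-abs-∧ (eval v b) (eval v c)
eval-cong v (∧-absorbs-∨ b c)   = Bool.∧-abs-∨ (eval v b) (eval v c)
eval-cong v (∨-distˡ-∧ b c d)   = Bool.∨-distribˡ-∧ (eval v b) (eval v c) (eval v d)
eval-cong v (∨-distʳ-∧ b c d)   = Bool.∨-distribʳ-∧ (eval v b) (eval v c) (eval v d)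
eval-cong v (∧-distˡ-∨ b c d)   = Bool.∧-distribˡ-∨ (eval v b) (eval v c) (eval v d)
eval-cong v (∧-distʳ-∨ b c d)   = Bool.∧-distribʳ-∨ (eval v b) (eval v c) (eval v d)
eval-cong v (∨-complˡ b)        = Bool.∨-inverseˡ (eval v b)
eval-cong v (∨-complʳ b)        = Bool.∨-inverseʳ (eval v b)
eval-cong v (∧-complˡ b)        = Bool.∧-inverseˡ (eval v b)
eval-cong v (∧-complʳ b)        = Bool.∧-inverseʳ (eval v b)

signed : Bool → BExp n → BExp n
signed true  b = b
signed false b = ∼ b

-- Structural induction on the expression: bounds for the parts combine into a bound for the whole,
-- with De Morgan turning negated parts into a negated conjunction or disjunction.
literals⇒signed-eval : (v : Subset n) → (∀ t → d ≤BA signed (lookup v t) (prim t)) →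
                       ∀ b → d ≤BA signed (eval v b) b
literals⇒signed-eval v lits 𝟘 = ≤BA-trans ≤BA-𝟙 (≤BA-reflexive (sym FreeBA.¬⊥≈⊤))
literals⇒signed-eval v lits 𝟙 = ≤BA-𝟙
literals⇒signed-eval v lits (prim t) = lits t
literals⇒signed-eval v lits (b ∧ c)
  with eval v b | literals⇒signed-eval v lits b | eval v c | literals⇒signed-eval v lits c
... | true  | d≤b  | true  | d≤c  = ∧-greatest d≤b d≤c
... | true  | _    | false | d≤∼c =
  ≤BA-trans d≤∼c (≤BA-trans ∨-upperʳ (≤BA-reflexive (sym (FreeBA.deMorgan₁ b c))))
... | false | d≤∼b | _     | _    =
  ≤BA-trans d≤∼b (≤BA-trans ∨-upperˡ (≤BA-reflexive (sym (FreeBA.deMorgan₁ b c))))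
literals⇒signed-eval v lits (b ∨ c)
  with eval v b | literals⇒signed-eval v lits b | eval v c | literals⇒signed-eval v lits c
... | true  | d≤b  | _     | _    = ≤BA-trans d≤b ∨-upperˡ
... | false | _    | true  | d≤c  = ≤BA-trans d≤c ∨-upperʳ
... | false | d≤∼b | false | d≤∼c =
  ≤BA-trans (∧-greatest d≤∼b d≤∼c) (≤BA-reflexive (sym (FreeBA.deMorgan₂ b c)))
literals⇒signed-eval v lits (∼ b) with eval v b | literals⇒signed-eval v lits b
... | true  | d≤b  = ≤BA-trans d≤b (≤BA-reflexive (sym (FreeBA.¬-involutive b)))
... | false | d≤∼b = d≤∼b

-- Shannon expansion: split `d` on each `x i` in turn, so that `d′` is `d` met with one literal per
-- `i`. The family `x` is arbitrary because the recursion continues with its tail.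
≤BA-by-literals : ∀ {m} (x : Fin m → BExp n) →
                  (∀ v {d′} → d′ ≤BA d → (∀ i → d′ ≤BA signed (lookup v i) (x i)) → d′ ≤BA c) →
                  d ≤BA c
≤BA-by-literals {m = zero} x h = h [] (≤BA-reflexive refl) λ ()
≤BA-by-literals {d = d} {c = c} {m = suc m} x h =
  ≤BA-cases (x zero) (branch true) (branch false)
  where
  branch : ∀ s → d ∧ signed s (x zero) ≤BA c
  branch s = ≤BA-by-literals (x ∘ suc) λ v d′≤ lits →
    h (s ∷ v) (≤BA-trans d′≤ ∧-lowerˡ)
      λ { zero → ≤BA-trans d′≤ ∧-lowerʳ ; (suc i) → lits i }

-- Completeness of the Boolean axioms for two-valued semantics. Once the literals of `v` are fixed,
-- what lies below `b` also lies below `∼ b`, because `v` falsifies `b`.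
unsatisfiable⇒≡𝟘 : (b : BExp n) → (∀ v → eval v b ≡ false) → b ≡BA 𝟘
unsatisfiable⇒≡𝟘 b unsat = ≤BA-𝟘⇒≡ (≤BA-by-literals prim λ v {d′} d′≤b lits →
  ≤BA-contradiction d′≤b
    (≡.subst (λ s → d′ ≤BA signed s b) (unsat v) (literals⇒signed-eval v lits b)))

-- Atoms and tests

-- There are finitely many valuations, so a search either finds a witness or shows the atom to be
-- zero.
At-satisfiable : (α : At n) → ∃[ v ] eval v (formula α) ≡ true
At-satisfiable α with anySubset? (λ v → eval v (formula α) Bool.≟ true)
... | yes sat = sat
... | no unsat = contradiction
  (unsatisfiable⇒≡𝟘 (formula α) λ v → Bool.¬-not λ eq → unsat (v , eq)) (nonzero α)

-- The valuation `v` satisfies `formula α ∧ b`, which is therefore nonzero; by minimality it is all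
-- of `formula α`.
satisfied⇒≤BA : (α : At n) {v : Subset n} → eval v (formula α) ≡ true →
                ∀ b → eval v b ≡ true → formula α ≤BA b
satisfied⇒≤BA α {v} v⊨α b v⊨b = ≤BA-resp (minimal α (formula α ∧ b) α∧b≢𝟘 ∧-lowerˡ) ∧-lowerʳ
  where
  α∧b≢𝟘 : ¬ formula α ∧ b ≡BA 𝟘
  α∧b≢𝟘 eq with () ← ≡.trans (≡.sym (≡.cong₂ Bool._∧_ v⊨α v⊨b)) (eval-cong v eq)

At-decides : (α : At n) (b : BExp n) → α ∈ ⟦ b ⟧ᵗ ⊎ α ∈ ⟦ ∼ b ⟧ᵗ
At-decides α b with At-satisfiable α
... | v , v⊨α with eval v b in eq
...   | true  = inj₁ (satisfied⇒≤BA α v⊨α b eq)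
...   | false = inj₂ (satisfied⇒≤BA α v⊨α (∼ b) (≡.cong not eq))

⟦𝟘⟧ᵗ-empty : (α : At n) → ¬ α ∈ ⟦ 𝟘 ⟧ᵗ
⟦𝟘⟧ᵗ-empty α = nonzero α ∘ ≤BA-𝟘⇒≡

-- Links the two forms of negation: guarded sums and loops use the complement of a set of atoms,
-- whereas `E` and U2 use a negated test.
⟦∼⟧ᵗ-∁ : (b : BExp n) → ⟦ ∼ b ⟧ᵗ ≐ ∁ ⟦ b ⟧ᵗ
⟦∼⟧ᵗ-∁ b =
  (λ {α} α≤∼b α≤b → ⟦𝟘⟧ᵗ-empty α (≤BA-contradiction α≤b α≤∼b)) ,
  (λ {α} α≰b → [ ⊥-elim ∘ α≰b , id ]′ (At-decides α b))

⟦∨⟧ᵗ-split : (b c : BExp n) {α : At n} → α ∈ ⟦ b ∨ c ⟧ᵗ → α ∈ ⟦ b ⟧ᵗ ⊎ α ∈ ⟦ c ⟧ᵗ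
⟦∨⟧ᵗ-split b c {α} α≤b∨c with At-decides α b | At-decides α c
... | inj₁ α≤b  | _         = inj₁ α≤b
... | inj₂ _    | inj₁ α≤c  = inj₂ α≤c
... | inj₂ α≤∼b | inj₂ α≤∼c = ⊥-elim (⟦𝟘⟧ᵗ-empty α (≤BA-contradiction α≤b∨c
  (≤BA-trans (∧-greatest α≤∼b α≤∼c) (≤BA-reflexive (sym (FreeBA.deMorgan₂ b c))))))

⟦∧⟧ᵗ-cong : {b b′ c c′ : BExp n} → ⟦ b ⟧ᵗ ≐ ⟦ b′ ⟧ᵗ → ⟦ c ⟧ᵗ ≐ ⟦ c′ ⟧ᵗ → ⟦ b ∧ c ⟧ᵗ ≐ ⟦ b′ ∧ c′ ⟧ᵗ
⟦∧⟧ᵗ-cong b≐b′ c≐c′ =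
  (λ {α} α≤ → ∧-greatest (proj₁ b≐b′ {α} (≤BA-trans α≤ ∧-lowerˡ))
                         (proj₁ c≐c′ {α} (≤BA-trans α≤ ∧-lowerʳ))) ,
  (λ {α} α≤ → ∧-greatest (proj₂ b≐b′ {α} (≤BA-trans α≤ ∧-lowerˡ))
                         (proj₂ c≐c′ {α} (≤BA-trans α≤ ∧-lowerʳ)))

⟦∨⟧ᵗ-cong : {b b′ c c′ : BExp n} → ⟦ b ⟧ᵗ ≐ ⟦ b′ ⟧ᵗ → ⟦ c ⟧ᵗ ≐ ⟦ c′ ⟧ᵗ → ⟦ b ∨ c ⟧ᵗ ≐ ⟦ b′ ∨ c′ ⟧ᵗ
⟦∨⟧ᵗ-cong {b = b} {b′} {c} {c′} b≐b′ c≐c′ =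
  (λ {α} → [ (λ α≤b → ≤BA-trans (proj₁ b≐b′ {α} α≤b) ∨-upperˡ)
           , (λ α≤c → ≤BA-trans (proj₁ c≐c′ {α} α≤c) ∨-upperʳ) ]′ ∘ ⟦∨⟧ᵗ-split b c {α}) ,
  (λ {α} → [ (λ α≤b′ → ≤BA-trans (proj₂ b≐b′ {α} α≤b′) ∨-upperˡ)
           , (λ α≤c′ → ≤BA-trans (proj₂ c≐c′ {α} α≤c′) ∨-upperʳ) ]′ ∘ ⟦∨⟧ᵗ-split b′ c′ {α})

⟦∼⟧ᵗ-cong : {b c : BExp n} → ⟦ b ⟧ᵗ ≐ ⟦ c ⟧ᵗ → ⟦ ∼ b ⟧ᵗ ≐ ⟦ ∼ c ⟧ᵗ
⟦∼⟧ᵗ-cong {b = b} {c} b≐c =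
  (λ {α} α≤∼b → proj₂ (⟦∼⟧ᵗ-∁ c) {α} (proj₁ (⟦∼⟧ᵗ-∁ b) {α} α≤∼b ∘ proj₂ b≐c {α})) ,
  (λ {α} α≤∼c → proj₂ (⟦∼⟧ᵗ-∁ b) {α} (proj₁ (⟦∼⟧ᵗ-∁ c) {α} α≤∼c ∘ proj₁ b≐c {α}))

-- Cuts `s` where `u` ends. It recovers the two factors of a fusion that is known only up to
-- equality of atoms.
++-split : ∀ {a ℓ} {A : Set a} {R : A → A → Set ℓ} u {w s : List A} → Pointwise R (u ++ w) s →
           ∃[ u′ ] ∃[ w′ ] s ≡ u′ ++ w′ × Pointwise R u u′ × Pointwise R w w′
++-split []      w≈s         = [] , _ , ≡.refl , [] , w≈s
++-split (_ ∷ u) (x≈y ∷ uw≈) with u′ , w′ , ≡.refl , u≈u′ , w≈w′ ← ++-split u uw≈ =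
  _ ∷ u′ , w′ , ≡.refl , x≈y ∷ u≈u′ , w≈w′

-- Language operations without the quotient

data ⌊_⌋ {a} {Act : Set a} {n : ℕ} (B : Pred (At n) 0ℓ) : Lang Act n where
  atom : ∀ {α} → α ∈ B → ⌊ B ⌋ (α , [])

infixl 7 _∙_

-- The second factor starts at the very atom where the first one ends, so fusion carries no equation
-- between atoms.
data _∙_ {a} {Act : Set a} {n : ℕ} (L K : Lang Act n) : Lang Act n where
  fuse : ∀ {α u w} → L (α , u) → K (lastAtom (α , u) , w) → (L ∙ K) (α , u ++ w)

If : Pred (At n) 0ℓ → Lang Act n → Lang Act n → Lang Act n
If B L K z = (firstAtom z ∈ B × z ∈ L) ⊎ (firstAtom z ∈ ∁ B × z ∈ K)

-- Runs unroll at the front, whereas the powers in `_^⟨_⟩` grow at the back.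
data While {a} {Act : Set a} {n : ℕ} (B : Pred (At n) 0ℓ) (L : Lang Act n) : Lang Act n where
  stop : ∀ {α} → α ∈ ∁ B → While B L (α , [])
  step : ∀ {z} → firstAtom z ∈ B → z ∈ L ∙ While B L → z ∈ While B L

module _ {a} {Act : Set a} {n : ℕ} where

  private
    variable
      B B′ : Pred (At n) 0ℓ
      L L′ K K′ M X : Lang Act n

  ∙-monoˡ : L ⊆ L′ → L ∙ K ⊆ L′ ∙ K
  ∙-monoˡ L⊆ (fuse l k) = fuse (L⊆ l) k

  ∙-monoʳ : K ⊆ K′ → L ∙ K ⊆ L ∙ K′
  ∙-monoʳ K⊆ (fuse l k) = fuse l (K⊆ k)

  ∙-cong : L ≐ L′ → K ≐ K′ → L ∙ K ≐ L′ ∙ K′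
  ∙-cong (L⊆ , L⊇) (K⊆ , K⊇) =
    ∙-monoˡ L⊆ ∘ ∙-monoʳ K⊆ , ∙-monoˡ L⊇ ∘ ∙-monoʳ K⊇

  -- Associativity of `++`, together with `foldl-++`: the last atom after `u ++ w₁` is found by
  -- reading `w₁` from the last atom after `u`.
  ∙-assoc : (L ∙ K) ∙ M ≐ L ∙ (K ∙ M)
  ∙-assoc {L} {K} {M} = to , from
    where
    to : (L ∙ K) ∙ M ⊆ L ∙ (K ∙ M)
    to (fuse {w = w₂} (fuse {α} {u} {w₁} l k) m) =
      ≡.subst (λ s → (L ∙ (K ∙ M)) (α , s)) (≡.sym (++-assoc u w₁ w₂))
        (fuse l (fuse k (≡.subst (λ β → M (β , w₂)) (foldl-++ _ α u w₁) m)))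

    from′ : ∀ {α u z} → L (α , u) → (K ∙ M) z → firstAtom z ≡ lastAtom (α , u) →
            ((L ∙ K) ∙ M) (α , u ++ proj₂ z)
    from′ {α} {u} l (fuse {u = w₁} {w = w₂} k m) ≡.refl =
      ≡.subst (λ s → ((L ∙ K) ∙ M) (α , s)) (++-assoc u w₁ w₂)
        (fuse (fuse l k) (≡.subst (λ β → M (β , w₂)) (≡.sym (foldl-++ _ α u w₁)) m))

    from : L ∙ (K ∙ M) ⊆ (L ∙ K) ∙ M
    from (fuse l km) = from′ l km ≡.refl

  ∙-testˡ : ⌊ B ⌋ ∙ L ≐ λ z → firstAtom z ∈ B × z ∈ L
  ∙-testˡ = (λ { (fuse (atom α∈B) l) → α∈B , l }) , (λ { (α∈B , l) → fuse (atom α∈B) l })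

  -- The set `B` is full without having to be `U` by definition; this covers the atoms below `𝟙`.
  ∙-identityʳ : (∀ α → α ∈ B) → L ∙ ⌊ B ⌋ ≐ L
  ∙-identityʳ {B = B} {L = L} all =
    (λ { (fuse {α} {u} l (atom _)) → ≡.subst (λ s → L (α , s)) (≡.sym (++-identityʳ u)) l }) ,
    (λ { {α , u} l → ≡.subst (λ s → (L ∙ ⌊ B ⌋) (α , s)) (++-identityʳ u) (fuse l (atom (all _))) })

  If-cong : B ≐ B′ → L ≐ L′ → K ≐ K′ → If B L K ≐ If B′ L′ K′
  If-cong (B⊆ , B⊇) (L⊆ , L⊇) (K⊆ , K⊇) =
    (λ { (inj₁ (α∈B , l)) → inj₁ (B⊆ α∈B , L⊆ l) ; (inj₂ (α∉B , k)) → inj₂ (α∉B ∘ B⊇ , K⊆ k) }) ,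
    (λ { (inj₁ (α∈B , l)) → inj₁ (B⊇ α∈B , L⊇ l) ; (inj₂ (α∉B , k)) → inj₂ (α∉B ∘ B⊆ , K⊇ k) })

  ∙-distribʳ-If : If B (L ∙ M) (K ∙ M) ≐ If B L K ∙ M
  ∙-distribʳ-If =
    (λ { (inj₁ (α∈B , fuse l m)) → fuse (inj₁ (α∈B , l)) m
       ; (inj₂ (α∉B , fuse k m)) → fuse (inj₂ (α∉B , k)) m }) ,
    (λ { (fuse (inj₁ (α∈B , l)) m) → inj₁ (α∈B , fuse l m)
       ; (fuse (inj₂ (α∉B , k)) m) → inj₂ (α∉B , fuse k m) })

  -- Induction on the run: the tail of a `step` is moved into `X` first, and closure then absorbs
  -- the iteration in front of it.
  While-least : ∀ X → (∀ {z} → firstAtom z ∈ B → z ∈ L ∙ X → z ∈ X) → ⌊ ∁ B ⌋ ⊆ X → While B L ⊆ X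
  While-least X closed base (stop α∉B) = base (atom α∉B)
  While-least X closed base (step α∈B (fuse l r)) =
    closed α∈B (fuse l (While-least X closed base r))

  While-cong : B ≐ B′ → L ≐ L′ → While B L ≐ While B′ L′
  While-cong {B} {B′} {L} {L′} (B⊆ , B⊇) (L⊆ , L⊇) =
    While-least (While B′ L′)
      (λ { α∈B (fuse l r) → step (B⊆ α∈B) (fuse (L⊆ l) r) })
      (λ { (atom α∉B) → stop (α∉B ∘ B⊇) }) ,
    While-least (While B L)
      (λ { α∈B (fuse l r) → step (B⊇ α∈B) (fuse (L⊇ l) r) })
      (λ { (atom α∉B) → stop (α∉B ∘ B⊆) })

  While-unfold : (∀ α → α ∈ B′) → While B L ≐ If B (L ∙ While B L) ⌊ B′ ⌋
  While-unfold all =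
    (λ { (stop α∉B) → inj₂ (α∉B , atom (all _)) ; (step α∈B lw) → inj₁ (α∈B , lw) }) ,
    (λ { (inj₁ (α∈B , lw)) → step α∈B lw ; (inj₂ (α∉B , atom _)) → stop α∉B })

  -- The loop followed by `K` solves the equation in the premise of W3.
  While-∙-unfold : While B L ∙ K ≐ If B (L ∙ (While B L ∙ K)) K
  While-∙-unfold {L = L} =
    (λ { (fuse (stop α∉B) k) → inj₂ (α∉B , k)
       ; (fuse (step α∈B lw) k) → inj₁ (α∈B , proj₁ (∙-assoc {L = L}) (fuse lw k)) }) ,
    [ (λ (α∈B , lwk) → step-∙ α∈B (proj₂ (∙-assoc {L = L}) lwk))
    , (λ (α∉B , k) → fuse (stop α∉B) k) ]′
    where
    step-∙ : ∀ {z} → firstAtom z ∈ B → z ∈ (L ∙ While B L) ∙ K → z ∈ While B L ∙ K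
    step-∙ α∈B (fuse lw k) = fuse (step α∈B lw) k

  While-If-skip : ∀ {C} → (∀ α → α ∈ B′) → While B (If C L ⌊ B′ ⌋) ≐ While B (⌊ C ⌋ ∙ L)
  While-If-skip {B = B} {L = L} {C} all =
    While-least (While B (⌊ C ⌋ ∙ L))
      (λ { α∈B (fuse (inj₁ (α∈C , l)) r) → step α∈B (fuse (fuse (atom α∈C) l) r)
         -- A skipped iteration contributes a single atom and no action, so the rest of the run is
         -- already the whole string.
         ; α∈B (fuse (inj₂ (_ , atom _)) r) → r })
      (λ { (atom α∉B) → stop α∉B }) ,
    While-least (While B (If C L _))
      (λ { α∈B (fuse (fuse (atom α∈C) l) r) → step α∈B (fuse (inj₁ (α∈C , l)) r) })
      (λ { (atom α∉B) → stop α∉B })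

  -- Every string of `L` contains an action, so unfolding `X` once leaves a strictly shorter string
  -- of `X`. The bound `k` on the length makes this recursion terminate.
  If-solution-⊆ : (∀ α → ¬ L (α , [])) → X ⊆ If B (L ∙ X) K → If B (L ∙ M) K ⊆ M → X ⊆ M
  If-solution-⊆ {L = L} {X = X} {B = B} {K = K} {M = M} productive X⊆ ⊆M = go _ ≤-refl
    where
    go : ∀ k {α s} → length s ≤ k → X (α , s) → M (α , s)
    unfolded : ∀ k {α s} → length s ≤ k → If B (L ∙ X) K (α , s) → M (α , s)
    go k s≤k x = unfolded k s≤k (X⊆ x)
    unfolded k s≤k (inj₂ r) = ⊆M (inj₂ r)
    unfolded k s≤k (inj₁ (α∈B , fuse {u = []} l x)) = ⊥-elim (productive _ l)
    -- The first action of the `L` part pays for the decrease of `k`; the remainder `w` is no longer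
    -- than `u ++ w`.
    unfolded (suc k) (s≤s s≤k) (inj₁ (α∈B , fuse {u = _ ∷ u} {w} l x)) =
      ⊆M (inj₁ (α∈B , fuse l (go k (≤-trans (length-++-≤ʳ w {u}) s≤k) x)))

-- Soundness for the semantics without the quotient

⟦_⟧ᶜ : Exp Act n → Lang Act n
⟦ act p ⟧ᶜ (α , u) = ∃[ β ] u ≡ [ p , β ]
⟦ test b ⟧ᶜ        = ⌊ ⟦ b ⟧ᵗ ⌋
⟦ e · f ⟧ᶜ         = ⟦ e ⟧ᶜ ∙ ⟦ f ⟧ᶜ
⟦ e +[ b ] f ⟧ᶜ    = If ⟦ b ⟧ᵗ ⟦ e ⟧ᶜ ⟦ f ⟧ᶜ
⟦ e ^[ b ] ⟧ᶜ      = While ⟦ b ⟧ᵗ ⟦ e ⟧ᶜ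

module _ {a} {Act : Set a} {n : ℕ} where

  ⌊⌋-cong : {B B′ : Pred (At n) 0ℓ} → B ≐ B′ → ⌊_⌋ {Act = Act} B ≐ ⌊ B′ ⌋
  ⌊⌋-cong (B⊆ , B⊇) = (λ { (atom α∈B) → atom (B⊆ α∈B) }) , (λ { (atom α∈B) → atom (B⊇ α∈B) })

  -- The congruence rules relate Boolean arguments by `≡ᴳ` between tests; this turns equality of
  -- their languages back into equality of sets of atoms.
  ⌊⌋-injective : {B B′ : Pred (At n) 0ℓ} → ⌊_⌋ {Act = Act} B ≐ ⌊ B′ ⌋ → B ≐ B′
  ⌊⌋-injective (⌊B⌋⊆ , ⌊B⌋⊇) =
    (λ α∈B → atom⁻ (⌊B⌋⊆ (atom α∈B))) , (λ α∈B → atom⁻ (⌊B⌋⊇ (atom α∈B)))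
    where
    atom⁻ : ∀ {B α} → ⌊_⌋ {Act = Act} B (α , []) → α ∈ B
    atom⁻ (atom α∈B) = α∈B

  []∈⟦⟧ᶜ⇒≤E : (e : Exp Act n) {α : At n} → (α , []) ∈ ⟦ e ⟧ᶜ → α ∈ ⟦ E e ⟧ᵗ
  []∈⟦⟧ᶜ⇒≤E e {α} h = go e h ≡.refl
    where
    -- The empty list becomes a variable with an equation, since matching on `fuse` yields the index
    -- `u ++ w`.
    go : (e : Exp Act n) → ∀ {u} → (α , u) ∈ ⟦ e ⟧ᶜ → u ≡ [] → α ∈ ⟦ E e ⟧ᵗ
    go (act p) (_ , ≡.refl) ()
    go (test b) (atom α≤b) _ = α≤b
    go (e · f) (fuse {u = []} {[]} x y) _ = ∧-greatest (go e x ≡.refl) (go f y ≡.refl)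
    go (e +[ b ] f) (inj₁ (α≤b , x)) eq = ≤BA-trans (∧-greatest α≤b (go e x eq)) ∨-upperˡ
    go (e +[ b ] f) (inj₂ (α≰b , x)) eq =
      ≤BA-trans (∧-greatest (proj₂ (⟦∼⟧ᵗ-∁ b) {α} α≰b) (go f x eq)) ∨-upperʳ
    go (e ^[ b ]) (stop α≰b) _ = proj₂ (⟦∼⟧ᵗ-∁ b) {α} α≰b
    -- An iteration without actions stays at `α`, so the shorter run `r` also starts there; the run
    -- finally stops at `α`, outside `b`.
    go (e ^[ b ]) (step _ (fuse {u = []} _ r)) eq = go (e ^[ b ]) r eq

  ⟦⟧ᶜ-sound : {e f : Exp Act n} → e ≡ᴳ f → ⟦ e ⟧ᶜ ≐ ⟦ f ⟧ᶜ
  ⟦test⟧ᵗ-sound : {b c : BExp n} → test {Act = Act} b ≡ᴳ test c → ⟦ b ⟧ᵗ ≐ ⟦ c ⟧ᵗ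

  ⟦test⟧ᵗ-sound p = ⌊⌋-injective (⟦⟧ᶜ-sound p)

  ⟦⟧ᶜ-sound refl = id , id
  ⟦⟧ᶜ-sound (sym p) = ≐-sym (⟦⟧ᶜ-sound p)
  ⟦⟧ᶜ-sound (trans p q) = ≐-trans (⟦⟧ᶜ-sound p) (⟦⟧ᶜ-sound q)
  ⟦⟧ᶜ-sound (·-cong p q) = ∙-cong (⟦⟧ᶜ-sound p) (⟦⟧ᶜ-sound q)
  ⟦⟧ᶜ-sound (+-cong p q r) = If-cong (⟦test⟧ᵗ-sound q) (⟦⟧ᶜ-sound p) (⟦⟧ᶜ-sound r)
  ⟦⟧ᶜ-sound (^-cong p q) = While-cong (⟦test⟧ᵗ-sound q) (⟦⟧ᶜ-sound p)
  ⟦⟧ᶜ-sound (test-∧-cong p q) = ⌊⌋-cong (⟦∧⟧ᵗ-cong (⟦test⟧ᵗ-sound p) (⟦test⟧ᵗ-sound q))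
  ⟦⟧ᶜ-sound (test-∨-cong p q) = ⌊⌋-cong (⟦∨⟧ᵗ-cong (⟦test⟧ᵗ-sound p) (⟦test⟧ᵗ-sound q))
  ⟦⟧ᶜ-sound (test-∼-cong p) = ⌊⌋-cong (⟦∼⟧ᵗ-cong (⟦test⟧ᵗ-sound p))
  ⟦⟧ᶜ-sound (BA b≡c) = ⌊⌋-cong
    ((λ α≤b → ≤BA-trans α≤b (≤BA-reflexive b≡c)) ,
     (λ α≤c → ≤BA-trans α≤c (≤BA-reflexive (sym b≡c))))
  ⟦⟧ᶜ-sound (test-∧ b c) =
    (λ { (atom α≤) → fuse (atom (≤BA-trans α≤ ∧-lowerˡ)) (atom (≤BA-trans α≤ ∧-lowerʳ)) }) ,
    (λ { (fuse (atom α≤b) (atom α≤c)) → atom (∧-greatest α≤b α≤c) })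
  ⟦⟧ᶜ-sound (U1 e b) =
    [ proj₂ , proj₂ ]′ ,
    (λ {z} x → [ (λ α≤b → inj₁ (α≤b , x))
               , (λ α≤∼b → inj₂ (proj₁ (⟦∼⟧ᵗ-∁ b) {firstAtom z} α≤∼b , x))
               ]′ (At-decides (firstAtom z) b))
  ⟦⟧ᶜ-sound (U2 e f b) =
    (λ { {z} (inj₁ (α≤b , x)) → inj₂ ((λ α≤∼b → proj₁ (⟦∼⟧ᵗ-∁ b) {firstAtom z} α≤∼b α≤b) , x)
       ; {z} (inj₂ (α≰b , y)) → inj₁ (proj₂ (⟦∼⟧ᵗ-∁ b) {firstAtom z} α≰b , y) }) ,
    (λ { {z} (inj₁ (α≤∼b , y)) → inj₂ (proj₁ (⟦∼⟧ᵗ-∁ b) {firstAtom z} α≤∼b , y)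
       ; {z} (inj₂ (α≰∼b , x)) →
           -- Deciding `b` at the first atom removes the double negation.
           inj₁ ([ id , ⊥-elim ∘ α≰∼b ]′ (At-decides (firstAtom z) b) , x) })
  ⟦⟧ᶜ-sound (U3 e f g b c) =
    (λ { (inj₁ (α≤c , inj₁ (α≤b , x))) → inj₁ (∧-greatest α≤b α≤c , x)
       ; (inj₁ (α≤c , inj₂ (α≰b , y))) →
           inj₂ ((λ α≤ → α≰b (≤BA-trans α≤ ∧-lowerˡ)) , inj₁ (α≤c , y))
       ; (inj₂ (α≰c , w)) → inj₂ ((λ α≤ → α≰c (≤BA-trans α≤ ∧-lowerʳ)) , inj₂ (α≰c , w)) }) ,
    (λ { (inj₁ (α≤ , x)) →
           inj₁ (≤BA-trans α≤ ∧-lowerʳ , inj₁ (≤BA-trans α≤ ∧-lowerˡ , x))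
       ; (inj₂ (α≰ , inj₁ (α≤c , y))) →
           inj₁ (α≤c , inj₂ ((λ α≤b → α≰ (∧-greatest α≤b α≤c)) , y))
       ; (inj₂ (_ , inj₂ r)) → inj₂ r })
  ⟦⟧ᶜ-sound (U4 e f b) =
    (λ { (inj₁ (α≤b , x)) → inj₁ (α≤b , fuse (atom α≤b) x) ; (inj₂ r) → inj₂ r }) ,
    (λ { (inj₁ (α≤b , x)) → inj₁ (proj₁ ∙-testˡ x) ; (inj₂ r) → inj₂ r })
  ⟦⟧ᶜ-sound (U5 e f g b) = ∙-distribʳ-If
  ⟦⟧ᶜ-sound (S1 e f g) = ∙-assoc {L = ⟦ e ⟧ᶜ}
  ⟦⟧ᶜ-sound (S2 e) =
    (λ { (fuse (atom {α} α≤𝟘) _) → ⊥-elim (⟦𝟘⟧ᵗ-empty α α≤𝟘) }) ,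
    (λ { (atom {α} α≤𝟘) → ⊥-elim (⟦𝟘⟧ᵗ-empty α α≤𝟘) })
  ⟦⟧ᶜ-sound (S3 e) =
    (λ { (fuse _ (atom {α} α≤𝟘)) → ⊥-elim (⟦𝟘⟧ᵗ-empty α α≤𝟘) }) ,
    (λ { (atom {α} α≤𝟘) → ⊥-elim (⟦𝟘⟧ᵗ-empty α α≤𝟘) })
  ⟦⟧ᶜ-sound (S4 e) = proj₂ ∘ proj₁ ∙-testˡ , λ x → proj₂ ∙-testˡ (≤BA-𝟙 , x)
  ⟦⟧ᶜ-sound (S5 e) = ∙-identityʳ λ _ → ≤BA-𝟙
  ⟦⟧ᶜ-sound (W1 e b) = While-unfold λ _ → ≤BA-𝟙
  ⟦⟧ᶜ-sound (W2 e b c) = While-If-skip λ _ → ≤BA-𝟙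
  ⟦⟧ᶜ-sound (W3 {e} {f} {g} {b} p E≡𝟘) with ⟦⟧ᶜ-sound p | ⟦test⟧ᵗ-sound E≡𝟘
  ... | g⊆ , g⊇ | E⊆𝟘 , _ =
    -- `g` and the loop followed by `f` solve the same equation; the second inclusion swaps their
    -- roles.
    If-solution-⊆ productive g⊆ (proj₂ (While-∙-unfold {K = ⟦ f ⟧ᶜ})) ,
    If-solution-⊆ productive (proj₁ (While-∙-unfold {K = ⟦ f ⟧ᶜ})) g⊇
    where
    productive : ∀ α → ¬ (α , []) ∈ ⟦ e ⟧ᶜ
    productive α x = ⟦𝟘⟧ᵗ-empty α (E⊆𝟘 {α} ([]∈⟦⟧ᶜ⇒≤E e x))

-- Comparison with the semantics up to ≈GS

-- The points are explicit because _≈At_ and _≈GS_ unfold to relations from which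
-- they cannot be inferred.
_Respects′_ : ∀ {a p ℓ} {A : Set a} → Pred A p → (A → A → Set ℓ) → Set _
P Respects′ _∼_ = ∀ x y → x ∼ y → x ∈ P → y ∈ P

module _ {a} {Act : Set a} {n : ℕ} where

  private
    variable
      B : Pred (At n) 0ℓ
      L K : Lang Act n

    ≈GS-refl : (z : GS Act n) → z ≈GS z
    ≈GS-refl z = Setoid.refl (GS-setoid Act n) {z}

  lastAtom-cong : ∀ {α β} (u w : List (Act × At n)) → (α , u) ≈GS (β , w) →
                  lastAtom (α , u) ≈At lastAtom (β , w)
  lastAtom-cong [] [] (α≈β , []) = α≈β
  lastAtom-cong ((_ , γ) ∷ u) ((_ , δ) ∷ w) (_ , (_ , γ≈δ) ∷ u≈w) =
    lastAtom-cong {γ} {δ} u w (γ≈δ , u≈w)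

  ⋄-resp : (L K : Lang Act n) → (L ⋄ K) Respects′ _≈GS_
  ⋄-resp L K y z = ⋄-resp-≈GS L K {y} {z}

  ⟦⟧-resp : (e : Exp Act n) → ⟦ e ⟧ Respects′ _≈GS_
  ⟦⟧-resp e y z = ⟦⟧-resp-≈GS e {y} {z}

  -- Closure under `≈GS` lets both factors be replaced by the matching pieces of the target string,
  -- where the fusion is literal.
  ⋄≐∙ : L Respects′ _≈GS_ → K Respects′ _≈GS_ → L ⋄ K ≐ L ∙ K
  ⋄≐∙ {L} {K} L-resp K-resp = to , from
    where
    to : L ⋄ K ⊆ L ∙ K
    to {α , s} ((β , u) , (γ , w) , l , k , d , β≈α , uw≈s)
      with u′ , w′ , ≡.refl , u≈u′ , w≈w′ ← ++-split u uw≈s =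
      fuse (L-resp (β , u) (α , u′) (β≈α , u≈u′) l)
           (K-resp (γ , w) (lastAtom (α , u′) , w′)
             -- `γ` equals the last atom of the old first factor by `d`, and hence that of the new
             -- one.
             (trans (sym d) (lastAtom-cong {β} {α} u u′ (β≈α , u≈u′)) , w≈w′) k)

    from : L ∙ K ⊆ L ⋄ K
    from (fuse {α} {u} {w} l k) =
      (α , u) , (lastAtom (α , u) , w) , l , k , refl , ≈GS-refl (α , u ++ w)

  ⌜⌝-resp : ⌜_⌝ {Act = Act} B Respects′ _≈GS_
  ⌜⌝-resp y z y≈z (α , α∈B , eq) =
    α , α∈B , Setoid.trans (GS-setoid Act n) {α , []} {y} {z} eq y≈z

  ⌜⌝≐⌊⌋ : B Respects′ _≈At_ → ⌜_⌝ {Act = Act} B ≐ ⌊ B ⌋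
  ⌜⌝≐⌊⌋ B-resp =
    (λ { {α , .[]} (β , β∈B , β≈α , []) → atom (B-resp β α β≈α β∈B) }) ,
    (λ { (atom {α} α∈B) → α , α∈B , ≈GS-refl (α , []) })

  ^-resp : ∀ k → (L ^ k) Respects′ _≈GS_
  ^-resp zero = ⌜⌝-resp
  ^-resp {L} (suc k) = ⋄-resp (L ^ k) L

  ∁-resp : B Respects′ _≈At_ → ∁ B Respects′ _≈At_
  ∁-resp B-resp α β α≈β α∉B = α∉B ∘ B-resp β α (sym α≈β)

  ⌜⌝⋄≐⌊⌋∙ : B Respects′ _≈At_ → L Respects′ _≈GS_ → ⌜ B ⌝ ⋄ L ≐ ⌊ B ⌋ ∙ L
  ⌜⌝⋄≐⌊⌋∙ {L = L} B-resp L-resp =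
    ≐-trans (⋄≐∙ ⌜⌝-resp L-resp) (∙-cong (⌜⌝≐⌊⌋ B-resp) (id , id))

  +⟨⟩≐If : B Respects′ _≈At_ → L Respects′ _≈GS_ → K Respects′ _≈GS_ → L +⟨ B ⟩ K ≐ If B L K
  +⟨⟩≐If {B} {L} {K} B-resp L-resp K-resp =
    [ inj₁ ∘ proj₁ L≐ , inj₂ ∘ proj₁ K≐ ]′ , [ inj₁ ∘ proj₂ L≐ , inj₂ ∘ proj₂ K≐ ]′
    where
    L≐ : ⌜ B ⌝ ⋄ L ≐ λ z → firstAtom z ∈ B × z ∈ L
    L≐ = ≐-trans (⌜⌝⋄≐⌊⌋∙ B-resp L-resp) ∙-testˡ

    K≐ : ⌜ ∁ B ⌝ ⋄ K ≐ λ z → firstAtom z ∈ ∁ B × z ∈ K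
    K≐ = ≐-trans (⌜⌝⋄≐⌊⌋∙ (∁-resp B-resp) K-resp) ∙-testˡ

  infixl 8 _^ᶜ_

  _^ᶜ_ : Lang Act n → ℕ → Lang Act n
  L ^ᶜ zero  = ⌊ U ⌋
  L ^ᶜ suc k = L ^ᶜ k ∙ L

  ^≐^ᶜ : L Respects′ _≈GS_ → L ≐ K → ∀ k → L ^ k ≐ K ^ᶜ k
  ^≐^ᶜ L-resp L≐K zero = ⌜⌝≐⌊⌋ _
  ^≐^ᶜ {L} L-resp L≐K (suc k) =
    ≐-trans (⋄≐∙ (^-resp k) L-resp) (∙-cong (^≐^ᶜ L-resp L≐K k) L≐K)

  -- Moves a factor from the front of a power to the back, reconciling the unrolling of `While` with
  -- the recursion of `_^ᶜ_`.
  ^ᶜ-comm : ∀ k → L ∙ L ^ᶜ k ⊆ L ^ᶜ suc k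
  ^ᶜ-comm zero = proj₂ ∙-testˡ ∘ (_ ,_) ∘ proj₁ (∙-identityʳ _)
  ^ᶜ-comm {L} (suc k) = ∙-monoˡ (^ᶜ-comm k) ∘ proj₂ (∙-assoc {L = L} {K = L ^ᶜ k})

  While≐⋃^ᶜ : While B L ≐ ⋃ ℕ λ k → (⌊ B ⌋ ∙ L) ^ᶜ k ∙ ⌊ ∁ B ⌋
  While≐⋃^ᶜ {B} {L} =
    While-least (⋃ ℕ iterate)
      (λ { α∈B (fuse l (k , r)) → suc k , prepend k (fuse (fuse (atom α∈B) l) r) })
      (λ { (atom α∉B) → zero , fuse (atom _) (atom α∉B) }) ,
    (λ (k , r) → absorb k (∙-monoʳ (λ { (atom α∉B) → stop α∉B }) r))
    where
    P : Lang Act n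
    P = ⌊ B ⌋ ∙ L

    iterate : ℕ → Lang Act n
    iterate k = P ^ᶜ k ∙ ⌊ ∁ B ⌋

    prepend : ∀ k → P ∙ iterate k ⊆ iterate (suc k)
    prepend k = ∙-monoˡ (^ᶜ-comm k) ∘ proj₂ (∙-assoc {L = P})

    -- Conversely, the last factor of the power becomes the first iteration of the run behind it,
    -- and so on down to the zeroth power.
    absorb : ∀ k → P ^ᶜ k ∙ While B L ⊆ While B L
    absorb zero    = proj₂ ∘ proj₁ ∙-testˡ
    absorb (suc k) = absorb k ∘
      ∙-monoʳ (λ { (fuse (fuse (atom α∈B) l) r) → step α∈B (fuse l r) }) ∘
      proj₁ (∙-assoc {L = P ^ᶜ k})

  ^⟨⟩≐While : B Respects′ _≈At_ → L Respects′ _≈GS_ → L ^⟨ B ⟩ ≐ While B L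
  ^⟨⟩≐While {B} {L} B-resp L-resp =
    ≐-trans ((λ (k , r) → k , proj₁ (iterate≐ k) r) , (λ (k , r) → k , proj₂ (iterate≐ k) r))
            (≐-sym While≐⋃^ᶜ)
    where
    iterate≐ : ∀ k → (⌜ B ⌝ ⋄ L) ^ k ⋄ ⌜ ∁ B ⌝ ≐ (⌊ B ⌋ ∙ L) ^ᶜ k ∙ ⌊ ∁ B ⌋
    iterate≐ k =
      ≐-trans (⋄≐∙ (^-resp k) ⌜⌝-resp)
        (∙-cong (^≐^ᶜ (⋄-resp ⌜ B ⌝ L) (⌜⌝⋄≐⌊⌋∙ B-resp L-resp) k)
                (⌜⌝≐⌊⌋ (∁-resp B-resp)))

  ⟦⟧ᵗ-resp : (b : BExp n) → ⟦ b ⟧ᵗ Respects′ _≈At_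
  ⟦⟧ᵗ-resp b _ _ α≈β = ≤BA-resp α≈β

  ⟦⟧≐⟦⟧ᶜ : (e : Exp Act n) → ⟦ e ⟧ ≐ ⟦ e ⟧ᶜ
  ⟦⟧≐⟦⟧ᶜ (act p) =
    (λ { {α , (.p , β) ∷ []} (_ , _ , _ , (≡.refl , _) ∷ []) → β , ≡.refl }) ,
    (λ { {α , _} (β , ≡.refl) → α , β , ≈GS-refl (α , [ p , β ]) })
  ⟦⟧≐⟦⟧ᶜ (test b) = ⌜⌝≐⌊⌋ (⟦⟧ᵗ-resp b)
  ⟦⟧≐⟦⟧ᶜ (e · f) =
    ≐-trans (⋄≐∙ (⟦⟧-resp e) (⟦⟧-resp f)) (∙-cong (⟦⟧≐⟦⟧ᶜ e) (⟦⟧≐⟦⟧ᶜ f))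
  ⟦⟧≐⟦⟧ᶜ (e +[ b ] f) = ≐-trans
    (+⟨⟩≐If (⟦⟧ᵗ-resp b) (⟦⟧-resp e) (⟦⟧-resp f))
    (If-cong (id , id) (⟦⟧≐⟦⟧ᶜ e) (⟦⟧≐⟦⟧ᶜ f))
  ⟦⟧≐⟦⟧ᶜ (e ^[ b ]) = ≐-trans
    (^⟨⟩≐While (⟦⟧ᵗ-resp b) (⟦⟧-resp e))
    (While-cong (id , id) (⟦⟧≐⟦⟧ᶜ e))

theorem3p3 : ∀ {a} (Act : Set a) → Act → (n : ℕ) → .{{_ : NonZero n}} →
    (e f : Exp Act n) → e ≡ᴳ f → ⟦ e ⟧ ≐ ⟦ f ⟧
theorem3p3 Act _ n e f e≡f =
  ≐-trans (⟦⟧≐⟦⟧ᶜ e) (≐-trans (⟦⟧ᶜ-sound e≡f) (≐-sym (⟦⟧≐⟦⟧ᶜ f)))
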